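{- Let $s,t$ be positive integers and let $C_{s,t}$ be the comet network of order $s+t$. Then the agglomeration of $C_{s,t}$ is $$\phi(C_{s,t})=\frac{3(s+t-1)}{t(t+1)(t+3s-1)+6s(s-1)}.$$
   Context: All graphs are finite, simple and undirected. The order of a graph is its number of nodes; $d_{uv}$ denotes the length of a shortest path between nodes $u$ and $v$. For a connected graph $H$ of order $m\ge 2$, the agglomeration is $$\phi(H)=\frac{m-1}{\sum_{u,v\in V(H),\,u\ne v} d_{uv}},$$ where the sum is over all ordered pairs $(u,v)$ of distinct nodes (equivalently $\phi(H)=1/(mL(H))$, where $L(H)=\frac{1}{m(m-1)}\sum_{u\neq v}d_{uv}$ is the average path length). For positive integers $s,t$, the comet $C_{s,t}$ is the tree obtained by identifying the center of the star $K_{1,s}$ with an end-node of the path $P_t$ of order $t$ (so $C_{s,1}\cong K_{1,s}$ and $C_{1,t}\cong P_{t+1}$). -}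

module Defs where

open import Data.Fin using (Fin; zero; suc; toℕ; _≟_; _↑ˡ_; _↑ʳ_; splitAt)
open import Data.Fin.Properties
  using (any?; splitAt-↑ˡ; splitAt-↑ʳ; splitAt⁻¹-↑ˡ; splitAt⁻¹-↑ʳ; ↑ˡ-injective; ↑ʳ-injective)
open import Data.Integer using (+_)
open import Data.List using (List; _∷_; map; filter; cartesianProduct; allFin)
open import Data.List.Membership.Propositional using (_∈_)
open import Data.List.Membership.Propositional.Properties
  using (∈-map⁺; ∈-filter⁺; ∈-cartesianProduct⁺; ∈-allFin)
open import Data.List.Relation.Unary.Any using (here; there)
open import Data.Nat
  using (ℕ; zero; suc; _+_; _*_; _∸_; _≤_; _<_; z≤n; s≤s; NonZero; NonTrivial;
         >-nonZero; >-nonZero⁻¹; n>1⇒nonTrivial)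
open import Data.Nat.ListAction using (sum)
import Data.Nat.Properties as ℕ
open import Data.Product using (∃; ∃₂; _×_; _,_; proj₁; proj₂; uncurry)
open import Data.Rational using (ℚ; _/_)
open import Data.Sum using (_⊎_; inj₁; inj₂; [_,_]′; swap)
import Data.Sum as Sum
open import Data.Vec using (Vec; []; _∷_; head; last)
open import Data.Vec.Relation.Unary.All using (All; []; _∷_)
open import Data.Vec.Relation.Unary.AllPairs using ([]; _∷_; allPairs?)
open import Data.Vec.Relation.Unary.Linked using (Linked; []; [-]; _∷_; linked?)
open import Data.Vec.Relation.Unary.Unique.Propositional using (Unique)
open import Function using (_∘_)
open import Level using (0ℓ)
open import Relation.Binary using (Rel; Decidable; Symmetric; Irreflexive)
open import Relation.Binary.Construct.Closure.ReflexiveTransitive as Star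
  using (Star; ε; _◅_; _◅◅_)
open import Relation.Binary.PropositionalEquality
  using (_≡_; _≢_; refl; sym; trans; cong; subst)
open import Relation.Nullary using (Dec; yes; no; ¬?; contradiction)
open import Relation.Nullary.Decidable using (_×-dec_; _⊎-dec_; map′)
import Relation.Unary as U

private
  variable
    m n : ℕ

record Graph (n : ℕ) : Set₁ where
  field
    Adj        : Rel (Fin n) 0ℓ
    adj?       : Decidable Adj
    adj-sym    : Symmetric Adj
    adj-irrefl : Irreflexive _≡_ Adj

open Graph public

-- A path of length k is listed by its k + 1 distinct vertices.
IsPath : (G : Graph n) (u v : Fin n) {k : ℕ} → Vec (Fin n) (suc k) → Set
IsPath G u v xs = head xs ≡ u × last xs ≡ v × Linked (Adj G) xs × Unique xs

HasPath : (G : Graph n) (u v : Fin n) (k : ℕ) → Set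
HasPath {n} G u v k = ∃ λ (xs : Vec (Fin n) (suc k)) → IsPath G u v xs

Connected : Graph n → Set
Connected G = ∀ u v → ∃ λ k → HasPath G u v k

IsDistance : (G : Graph n) (u v : Fin n) (d : ℕ) → Set
IsDistance G u v d = HasPath G u v d × (∀ k → HasPath G u v k → d ≤ k)

anyVec? : ∀ {k} {P : Vec (Fin n) k → Set} → U.Decidable P → Dec (∃ P)
anyVec? {k = zero}  P? = map′ ([] ,_) (λ { ([] , p) → p }) (P? [])
anyVec? {k = suc k} P? =
  map′ (λ { (x , xs , p) → (x ∷ xs) , p }) (λ { ((x ∷ xs) , p) → x , xs , p })
       (any? λ x → anyVec? λ xs → P? (x ∷ xs))

hasPath? : (G : Graph n) (u v : Fin n) → U.Decidable (HasPath G u v)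
hasPath? G u v k = anyVec? λ xs →
  (head xs ≟ u) ×-dec (last xs ≟ v) ×-dec linked? (adj? G) xs
    ×-dec allPairs? (λ x y → ¬? (x ≟ y)) xs

least : {P : ℕ → Set} → U.Decidable P → ∀ k → P k → ∃ λ d → P d × (∀ j → P j → d ≤ j)
least P? k p with P? 0
least P? k       p | yes p₀ = 0 , p₀ , λ _ _ → z≤n
least P? zero    p | no ¬p₀ = contradiction p ¬p₀
least {P} P? (suc k) p | no ¬p₀ with least (P? ∘ suc) k p
... | d , pd , min = suc d , pd , λ where
  zero    p₀ → contradiction p₀ ¬p₀
  (suc j) pj → s≤s (min j pj)

shortest : (G : Graph n) → Connected G → ∀ u v → ∃ (IsDistance G u v)
shortest G conn u v = uncurry (least (hasPath? G u v)) (conn u v)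

dist : (G : Graph n) → Connected G → Fin n → Fin n → ℕ
dist G conn u v = proj₁ (shortest G conn u v)

distinctPairs : ∀ n → List (Fin n × Fin n)
distinctPairs n = filter (λ (u , v) → ¬? (u ≟ v)) (cartesianProduct (allFin n) (allFin n))

distanceSum : (G : Graph n) → Connected G → ℕ
distanceSum {n} G conn = sum (map (λ (u , v) → dist G conn u v) (distinctPairs n))

dist-pos : (G : Graph n) (conn : Connected G) → ∀ {u v} → u ≢ v → 0 < dist G conn u v
dist-pos G conn {u} {v} u≢v with shortest G conn u v
... | suc d , _ = s≤s z≤n
... | zero  , ((x ∷ []) , x≡u , x≡v , _) , _ = contradiction (trans (sym x≡u) x≡v) u≢v

∈⇒≤sum : ∀ {x xs} → x ∈ xs → x ≤ sum xs
∈⇒≤sum {xs = x ∷ xs} (here refl) = ℕ.m≤m+n x (sum xs)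
∈⇒≤sum {xs = y ∷ xs} (there x∈)  = ℕ.≤-trans (∈⇒≤sum x∈) (ℕ.m≤n+m (sum xs) y)

distanceSum-nonZero : .{{NonTrivial n}} → (G : Graph n) (conn : Connected G) →
                      NonZero (distanceSum G conn)
distanceSum-nonZero {n = suc (suc n)} G conn = >-nonZero (ℕ.<-≤-trans
  (dist-pos G conn {zero} {suc zero} λ ())
  (∈⇒≤sum (∈-map⁺ (λ (u , v) → dist G conn u v)
    (∈-filter⁺ (λ (u , v) → ¬? (u ≟ v))
      (∈-cartesianProduct⁺ (∈-allFin zero) (∈-allFin (suc zero))) λ ()))))

agglomeration : .{{NonTrivial n}} → (G : Graph n) → Connected G → ℚ
agglomeration {n} G conn = (+ (n ∸ 1) / distanceSum G conn) {{distanceSum-nonZero G conn}}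

-- K_{1,s}, with centre zero.
star : ∀ s → Graph (suc s)
star s = record
  { Adj        = λ u v → (u ≡ zero × v ≢ zero) ⊎ (u ≢ zero × v ≡ zero)
  ; adj?       = λ u v → ((u ≟ zero) ×-dec ¬? (v ≟ zero)) ⊎-dec (¬? (u ≟ zero) ×-dec (v ≟ zero))
  ; adj-sym    = λ { (inj₁ (p , q)) → inj₂ (q , p) ; (inj₂ (p , q)) → inj₁ (q , p) }
  ; adj-irrefl = λ { refl (inj₁ (p , q)) → q p ; refl (inj₂ (p , q)) → p q }
  }

pathGraph : ∀ t → Graph t
pathGraph t = record
  { Adj        = λ u v → toℕ v ≡ suc (toℕ u) ⊎ toℕ u ≡ suc (toℕ v)
  ; adj?       = λ u v → (toℕ v ℕ.≟ suc (toℕ u)) ⊎-dec (toℕ u ℕ.≟ suc (toℕ v))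
  ; adj-sym    = swap
  ; adj-irrefl = λ { refl (inj₁ e) → ℕ.1+n≢n (sym e) ; refl (inj₂ e) → ℕ.1+n≢n (sym e) }
  }

Image : (Fin m → Fin n) → Rel (Fin m) 0ℓ → Rel (Fin n) 0ℓ
Image f R x y = ∃₂ λ u v → R u v × f u ≡ x × f v ≡ y

image? : (f : Fin m → Fin n) {R : Rel (Fin m) 0ℓ} → Decidable R → Decidable (Image f R)
image? f R? x y = any? λ u → any? λ v → R? u v ×-dec (f u ≟ x) ×-dec (f v ≟ y)

image-sym : (f : Fin m → Fin n) {R : Rel (Fin m) 0ℓ} → Symmetric R → Symmetric (Image f R)
image-sym f R-sym (u , v , r , p , q) = v , u , R-sym r , q , p

image-irrefl : (f : Fin m → Fin n) {R : Rel (Fin m) 0ℓ} → (∀ {u v} → f u ≡ f v → u ≡ v) →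
               Irreflexive _≡_ R → Irreflexive _≡_ (Image f R)
image-irrefl f inj R-irr refl (u , v , r , p , q) = R-irr (inj (trans p (sym q))) r

-- Where the vertices of the first graph go when its vertex zero is identified
-- with vertex h of the second; the second graph's vertices go along m ↑ʳ_.
embedˡ : ∀ m {n} → Fin n → Fin (suc m) → Fin (m + n)
embedˡ m     h zero    = m ↑ʳ h
embedˡ m {n} h (suc i) = i ↑ˡ n

↑ʳ≢↑ˡ : ∀ {m n} (i : Fin m) (j : Fin n) → m ↑ʳ j ≢ i ↑ˡ n
↑ʳ≢↑ˡ {m} {n} i j e
  with () ← trans (sym (splitAt-↑ʳ m n j)) (trans (cong (splitAt m) e) (splitAt-↑ˡ m i n))

embedˡ-injective : ∀ m {n} (h : Fin n) {u v} → embedˡ m h u ≡ embedˡ m h v → u ≡ v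
embedˡ-injective m h {zero}  {zero}  e = refl
embedˡ-injective m h {zero}  {suc j} e = contradiction e (↑ʳ≢↑ˡ j h)
embedˡ-injective m h {suc i} {zero}  e = contradiction (sym e) (↑ʳ≢↑ˡ i h)
embedˡ-injective m h {suc i} {suc j} e = cong suc (↑ˡ-injective _ i j e)

-- The graph obtained from the disjoint union of G and H by identifying
-- vertex zero of G with vertex h of H.
coalesce : Graph (suc m) → (H : Graph n) → Fin n → Graph (m + n)
coalesce {m} {n} G H h = record
  { Adj        = λ x y → Image (embedˡ m h) (Adj G) x y ⊎ Image (m ↑ʳ_) (Adj H) x y
  ; adj?       = λ x y → image? (embedˡ m h) (adj? G) x y ⊎-dec image? (m ↑ʳ_) (adj? H) x y
  ; adj-sym    = Sum.map (image-sym (embedˡ m h) (adj-sym G)) (image-sym (m ↑ʳ_) (adj-sym H))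
  ; adj-irrefl = λ e → [ image-irrefl (embedˡ m h) (embedˡ-injective m h) (adj-irrefl G) e
                       , image-irrefl (m ↑ʳ_) (↑ʳ-injective m _ _) (adj-irrefl H) e ]′
  }

comet : ∀ s t → .{{NonZero t}} → Graph (s + t)
comet s (suc t) = coalesce (star s) (pathGraph (suc t)) zero

freshOrSuffix : (G : Graph n) (u : Fin n) {k : ℕ} (xs : Vec (Fin n) (suc k)) →
                Linked (Adj G) xs → Unique xs →
                All (u ≢_) xs ⊎ ∃ (HasPath G u (last xs))
freshOrSuffix G u (x ∷ xs) l d with u ≟ x
freshOrSuffix G u (x ∷ xs)     l       d       | yes u≡x = inj₂ (_ , (x ∷ xs) , sym u≡x , refl , l , d)
freshOrSuffix G u (x ∷ [])     l       d       | no u≢x  = inj₁ (u≢x ∷ [])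
freshOrSuffix G u (x ∷ y ∷ ys) (_ ∷ l) (_ ∷ d) | no u≢x  =
  Sum.map₁ (u≢x ∷_) (freshOrSuffix G u (y ∷ ys) l d)

walk⇒path : (G : Graph n) → ∀ {u v} → Star (Adj G) u v → ∃ (HasPath G u v)
walk⇒path G {u} ε = 0 , (u ∷ []) , refl , refl , [-] , ([] ∷ [])
walk⇒path G {u} (a ◅ w) with walk⇒path G w
... | k , xs , refl , refl , l , d with freshOrSuffix G u xs l d
...   | inj₁ fresh = suc k , (u ∷ xs) , refl , refl , (a ∷ l) , (fresh ∷ d)
...   | inj₂ path  = path

reachable⇒connected : (G : Graph n) (r : Fin n) → (∀ v → Star (Adj G) r v) → Connected G
reachable⇒connected G r reach u v =
  walk⇒path G (Star.reverse (adj-sym G) (reach u) ◅◅ reach v)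

star-reachable : ∀ s v → Star (Adj (star s)) zero v
star-reachable s zero    = ε
star-reachable s (suc i) = inj₁ (refl , λ ()) ◅ ε

pathGraph-reachable : ∀ t v → Star (Adj (pathGraph (suc t))) zero v
pathGraph-reachable t       zero    = ε
pathGraph-reachable (suc t) (suc i) =
  inj₁ refl ◅ Star.gmap suc (Sum.map (cong suc) (cong suc)) (pathGraph-reachable t i)

coalesce-reachable : (G : Graph (suc m)) (H : Graph n) (h : Fin n) →
                     (∀ u → Star (Adj G) zero u) → (∀ v → Star (Adj H) h v) →
                     ∀ x → Star (Adj (coalesce G H h)) (m ↑ʳ h) x
coalesce-reachable {m} {n} G H h reachG reachH x with splitAt m x in eq
... | inj₁ i = subst (Star _ _) (splitAt⁻¹-↑ˡ eq)
  (Star.gmap (embedˡ m h) (λ a → inj₁ (_ , _ , a , refl , refl)) (reachG (suc i)))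
... | inj₂ j = subst (Star _ _) (splitAt⁻¹-↑ʳ eq)
  (Star.gmap (m ↑ʳ_) (λ a → inj₂ (_ , _ , a , refl , refl)) (reachH j))

comet-connected : ∀ s t → .{{_ : NonZero t}} → Connected (comet s t)
comet-connected s (suc t) = reachable⇒connected (comet s (suc t)) (s ↑ʳ zero)
  (coalesce-reachable (star s) (pathGraph (suc t)) zero
    (star-reachable s) (pathGraph-reachable t))

comet-nonTrivial : ∀ s t → .{{_ : NonZero s}} → .{{_ : NonZero t}} → NonTrivial (s + t)
comet-nonTrivial s t = n>1⇒nonTrivial (ℕ.+-mono-≤ (>-nonZero⁻¹ s) (>-nonZero⁻¹ t))

denominator-nonZero : ∀ s t → .{{_ : NonZero s}} → .{{_ : NonZero t}} →
                      NonZero (t * (t + 1) * (t + 3 * s ∸ 1) + 6 * s * (s ∸ 1))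
denominator-nonZero (suc s) (suc t) = >-nonZero (ℕ.<-≤-trans
  (ℕ.*-mono-< {0} {suc t * (suc t + 1)} {0} {t + 3 * suc s}
    (s≤s z≤n) (ℕ.<-≤-trans (s≤s z≤n) (ℕ.m≤n+m (3 * suc s) t)))
  (ℕ.m≤m+n _ (6 * suc s * s)))

{-# OPTIONS --safe #-}

-- The distance to a vertex v is the only potential that vanishes exactly at v,
-- changes by at most one along each edge, and can be lowered by one at every
-- other vertex. This identifies the distances in the comet: 2 between two
-- leaves, j + 1 between a leaf and the j-th path vertex, ∣ i - j ∣ on the path.
-- With R = ∑ (j + 1) = t(t+1)/2 and the path contribution t(t²-1)/3, the ordered
-- distance sum is 2s(s-1) + 2sR + t(t²-1)/3, a third of the stated denominator.
module Submission where

open import Defs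
import Algebra.Properties.CommutativeMonoid.Sum as Sums
open import Data.Bool using (if_then_else_)
open import Data.Fin using (Fin; zero; suc; toℕ; _≟_; _↑ˡ_; _↑ʳ_; splitAt; join; inject₁)
open import Data.Fin.Properties
  using (splitAt-↑ˡ; splitAt-↑ʳ; splitAt-join; join-splitAt; toℕ-inject₁; toℕ-injective)
open import Data.Integer using (+_)
import Data.Integer as ℤ
import Data.Integer.Properties as ℤ
open import Data.List using (List; []; _∷_; map; filter; cartesianProduct; allFin; tabulate; _++_)
open import Data.List.Properties using (map-++; map-∘; map-tabulate)
import Data.Nat.ListAction as List
open import Data.Nat.ListAction.Properties using (sum-++)
open import Data.Nat using (ℕ; zero; suc; NonZero; _+_; _*_; _∸_; _≤_; z≤n; s≤s; ∣_-_∣)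
import Data.Nat.Properties as ℕ
open import Data.Nat.Tactic.RingSolver using (solve-∀)
open import Data.Product using (∃; _×_; _,_; proj₁; proj₂)
open import Data.Rational using (_/_)
open import Data.Rational.Properties using (fromℚᵘ-cong)
open import Data.Rational.Unnormalised using (mkℚᵘ; *≡*)
open import Data.Sum using (_⊎_; inj₁; inj₂)
open import Data.Vec using (Vec; []; _∷_; head; last)
open import Data.Vec.Relation.Unary.All as All using (All; []; _∷_)
open import Data.Vec.Relation.Unary.AllPairs using ([]; _∷_)
open import Data.Vec.Relation.Unary.Linked using (Linked; [-]; _∷_)
open import Function using (id; _∘_)
open import Relation.Binary.PropositionalEquality
  using (_≡_; _≢_; refl; sym; trans; cong; cong₂; subst; module ≡-Reasoning)
open import Relation.Nullary using (¬_; yes; no; does; contradiction)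
open import Relation.Nullary.Decidable using (decidable-stable)
import Relation.Unary as U

open Sums ℕ.+-0-commutativeMonoid using (sum-syntax; sum-cong-≗; ∑-distrib-+; ∑-comm)

private
  variable
    n : ℕ

-- Distances computed by potentials.

module _ (G : Graph n) (v : Fin n) (h : Fin n → ℕ)
         (h-target    : h v ≡ 0)
         (h-faithful  : ∀ {x} → h x ≡ 0 → x ≡ v)
         (h-lipschitz : ∀ {x y} → Adj G x y → h x ≤ suc (h y))
         (h-descent   : ∀ {x k} → h x ≡ suc k → ∃ λ y → Adj G x y × h y ≡ k)
         where

  -- Each edge can lower the potential by at most one. For paths ending at `v`, where `h` vanishes,
  -- this bounds the length from below by the initial potential.
  linked-potential : ∀ {k} (xs : Vec (Fin n) (suc k)) → Linked (Adj G) xs →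
                     h (head xs) ≤ k + h (last xs)
  linked-potential (x ∷ [])     _       = ℕ.≤-refl
  linked-potential (x ∷ y ∷ ys) (a ∷ l) =
    ℕ.≤-trans (h-lipschitz a) (s≤s (linked-potential (y ∷ ys) l))

  -- The bound on the potential keeps the vertices of the path distinct.
  descending-path : ∀ k {u} → h u ≡ k →
                    ∃ λ (xs : Vec (Fin n) (suc k)) → IsPath G u v xs × All (λ x → h x ≤ k) xs
  descending-path zero {u} eq =
    (u ∷ []) , (refl , h-faithful eq , [-] , ([] ∷ [])) , (ℕ.≤-reflexive eq ∷ [])
  descending-path (suc k) {u} eq with h-descent eq
  ... | y , a , eq′ with descending-path k eq′
  ...   | (.y ∷ ys) , (refl , l≡v , l , d) , low =
    (u ∷ y ∷ ys)
    , (refl , l≡v , (a ∷ l) , (All.map fresh low ∷ d))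
    , (ℕ.≤-reflexive eq ∷ All.map ℕ.m≤n⇒m≤1+n low)
    where
    fresh : ∀ {x} → h x ≤ k → u ≢ x
    fresh hx≤k refl = ℕ.1+n≰n (subst (_≤ k) eq hx≤k)

  -- The descending path has length `h u`, so minimality bounds the distance above;
  -- `linked-potential` on a shortest path bounds it below.
  dist-potential : (conn : Connected G) → ∀ u → dist G conn u v ≡ h u
  dist-potential conn u with shortest G conn u v
  ... | d , (xs , refl , l≡v , l , _) , minimal with descending-path (h u) refl
  ...   | ys , path , _ = ℕ.≤-antisym (minimal (h u) (ys , path)) (begin
    h u              ≤⟨ linked-potential xs l ⟩
    d + h (last xs)  ≡⟨ cong (λ x → d + h x) l≡v ⟩
    d + h v          ≡⟨ cong (λ k → d + k) h-target ⟩
    d + 0            ≡⟨ ℕ.+-identityʳ d ⟩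
    d                ∎)
    where open ℕ.≤-Reasoning

-- Distances in the path graph and in the comet.

pathGraph-lipschitz : ∀ {i j : Fin n} k → Adj (pathGraph n) i j → ∣ toℕ i - k ∣ ≤ suc ∣ toℕ j - k ∣
pathGraph-lipschitz {i = i} {j} k a = begin
  ∣ toℕ i - k ∣                        ≤⟨ ℕ.∣-∣-triangle (toℕ i) (toℕ j) k ⟩
  ∣ toℕ i - toℕ j ∣ + ∣ toℕ j - k ∣    ≡⟨ cong (_+ ∣ toℕ j - k ∣) (step a) ⟩
  suc ∣ toℕ j - k ∣                    ∎
  where
  open ℕ.≤-Reasoning
  step⁺ : ∀ m → ∣ m - suc m ∣ ≡ 1
  step⁺ zero    = refl
  step⁺ (suc m) = step⁺ m
  step : Adj (pathGraph _) i j → ∣ toℕ i - toℕ j ∣ ≡ 1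
  step (inj₁ e) rewrite e = step⁺ (toℕ i)
  step (inj₂ e) rewrite e = trans (ℕ.∣-∣-comm (suc (toℕ j)) (toℕ j)) (step⁺ (toℕ j))

-- The neighbour on the side of `j` is chosen. Removing a common successor preserves both adjacency
-- and difference, so the recursion ends when one index is zero and the direction is evident.
pathGraph-descent : ∀ (i j : Fin n) {k} → ∣ toℕ i - toℕ j ∣ ≡ suc k →
                    ∃ λ i′ → Adj (pathGraph n) i i′ × ∣ toℕ i′ - toℕ j ∣ ≡ k
-- The second index is split only to reveal that `n` is at least 2, so that the witness `suc zero`
-- exists.
pathGraph-descent zero    (suc zero)    refl = suc zero , inj₁ refl , refl
pathGraph-descent zero    (suc (suc j)) refl = suc zero , inj₁ refl , refl
pathGraph-descent (suc i) zero          refl =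
  -- The predecessor of `suc i`, taken in the same `Fin n`.
  inject₁ i , inj₂ (cong suc (sym (toℕ-inject₁ i))) , trans (ℕ.∣-∣-identityʳ _) (toℕ-inject₁ i)
pathGraph-descent (suc i) (suc j)       eq with pathGraph-descent i j eq
... | i′ , inj₁ e , eq′ = suc i′ , inj₁ (cong suc e) , eq′
... | i′ , inj₂ e , eq′ = suc i′ , inj₂ (cong suc e) , eq′

-- The vertices of the comet are its s leaves and the vertices of its path, whose
-- vertex zero is the centre of the star.
data CometAdj (s t : ℕ) : (p q : Fin s ⊎ Fin (suc t)) → Set where
  centre-leaf : ∀ {i} → CometAdj s t (inj₂ zero) (inj₁ i)
  leaf-centre : ∀ {i} → CometAdj s t (inj₁ i) (inj₂ zero)
  along-path  : ∀ {i j} → Adj (pathGraph (suc t)) i j → CometAdj s t (inj₂ i) (inj₂ j)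

comet-adj⁻ : ∀ s t {x y} → Adj (comet s (suc t)) x y → CometAdj s t (splitAt s x) (splitAt s y)
comet-adj⁻ s t (inj₁ (zero , suc i , _ , refl , refl))
  rewrite splitAt-↑ʳ s (suc t) zero | splitAt-↑ˡ s i (suc t) = centre-leaf
comet-adj⁻ s t (inj₁ (suc i , zero , _ , refl , refl))
  rewrite splitAt-↑ʳ s (suc t) zero | splitAt-↑ˡ s i (suc t) = leaf-centre
-- The remaining star cases are void: the centre has no loop, and no two leaves are adjacent.
comet-adj⁻ s t (inj₁ (zero , zero , inj₁ (_ , v≢0) , _)) = contradiction refl v≢0
comet-adj⁻ s t (inj₁ (zero , zero , inj₂ (u≢0 , _) , _)) = contradiction refl u≢0
comet-adj⁻ s t (inj₁ (suc _ , suc _ , inj₁ (() , _) , _))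
comet-adj⁻ s t (inj₁ (suc _ , suc _ , inj₂ (_ , ()) , _))
comet-adj⁻ s t (inj₂ (i , j , a , refl , refl))
  rewrite splitAt-↑ʳ s (suc t) i | splitAt-↑ʳ s (suc t) j = along-path a

comet-adj⁺ : ∀ s t {p q} → CometAdj s t p q →
             Adj (comet s (suc t)) (join s (suc t) p) (join s (suc t) q)
comet-adj⁺ s t (centre-leaf {i}) = inj₁ (zero , suc i , inj₁ (refl , λ ()) , refl , refl)
comet-adj⁺ s t (leaf-centre {i}) = inj₁ (suc i , zero , inj₂ ((λ ()) , refl) , refl , refl)
comet-adj⁺ s t (along-path a)    = inj₂ (_ , _ , a , refl , refl)

-- Branching on `does` lets `leafDist (suc i) (suc j)` reduce to `leafDist i j`, which the induction
-- in `∑-leafDist` relies on.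
leafDist : Fin n → Fin n → ℕ
leafDist i j = if does (i ≟ j) then 0 else 2

leafDist-refl : (i : Fin n) → leafDist i i ≡ 0
leafDist-refl i with i ≟ i
... | yes _  = refl
... | no i≢i = contradiction refl i≢i

cometDist : ∀ {s t} → Fin s ⊎ Fin t → Fin s ⊎ Fin t → ℕ
cometDist (inj₁ i) (inj₁ j) = leafDist i j
cometDist (inj₁ i) (inj₂ j) = suc (toℕ j)
cometDist (inj₂ i) (inj₁ j) = suc (toℕ i)
cometDist (inj₂ i) (inj₂ j) = ∣ toℕ i - toℕ j ∣

cometDist-refl : ∀ {s t} (p : Fin s ⊎ Fin t) → cometDist p p ≡ 0
cometDist-refl (inj₁ i) = leafDist-refl i
cometDist-refl (inj₂ i) = ℕ.∣n-n∣≡0 (toℕ i)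

cometDist-zero : ∀ {s t} (p q : Fin s ⊎ Fin t) → cometDist p q ≡ 0 → p ≡ q
cometDist-zero (inj₁ i) (inj₁ j) eq with i ≟ j | eq
... | yes i≡j | _  = cong inj₁ i≡j
... | no _    | ()
cometDist-zero (inj₂ i) (inj₂ j) eq = cong inj₂ (toℕ-injective (ℕ.∣m-n∣≡0⇒m≡n eq))

cometDist-lipschitz : ∀ {s t p q} r → CometAdj s t p q → cometDist p r ≤ suc (cometDist q r)
cometDist-lipschitz (inj₁ j) centre-leaf = s≤s z≤n
cometDist-lipschitz (inj₂ j) centre-leaf = ℕ.m≤n+m (toℕ j) 2
cometDist-lipschitz (inj₁ j) (leaf-centre {i}) with i ≟ j
... | yes _ = z≤n
... | no _  = ℕ.≤-refl
cometDist-lipschitz (inj₂ j) leaf-centre = ℕ.≤-refl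
-- A leaf is one step beyond the centre, which has index 0, so the bound for 0 is shifted by one.
-- Binding it first lets the rewrites simplify its differences with 0.
cometDist-lipschitz (inj₁ j) (along-path {i} {i′} a)
  with s≤s i≤ ← s≤s (pathGraph-lipschitz 0 a)
  rewrite ℕ.∣-∣-identityʳ (toℕ i) | ℕ.∣-∣-identityʳ (toℕ i′) = s≤s i≤
cometDist-lipschitz (inj₂ j) (along-path a) = pathGraph-lipschitz (toℕ j) a

-- The step follows the only route in the tree: a leaf moves to the centre, the centre moves to the
-- target leaf, and every other step stays on the path.
cometDist-descent : ∀ {s t} p q {k} → cometDist p q ≡ suc k →
                    ∃ λ p′ → CometAdj s t p p′ × cometDist p′ q ≡ k
cometDist-descent (inj₁ i) (inj₁ j) eq with i ≟ j | eq
... | yes _ | ()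
... | no _  | refl = inj₂ zero , leaf-centre , refl
cometDist-descent (inj₁ i)       (inj₂ j) refl = inj₂ zero , leaf-centre , refl
cometDist-descent (inj₂ zero)    (inj₁ j) refl = inj₁ j , centre-leaf , leafDist-refl j
cometDist-descent (inj₂ (suc i)) (inj₁ j) refl =
  inj₂ (inject₁ i) , along-path (inj₂ (cong suc (sym (toℕ-inject₁ i)))) , cong suc (toℕ-inject₁ i)
cometDist-descent (inj₂ i)       (inj₂ j) eq with pathGraph-descent i j eq
... | i′ , a , eq′ = inj₂ i′ , along-path a , eq′

-- `splitAt` and `join` are mutually inverse, so the properties of `cometDist` carry over to the
-- vertices in `Fin (s + suc t)`.
comet-dist : ∀ s t (conn : Connected (comet s (suc t))) x y →
             dist (comet s (suc t)) conn x y ≡ cometDist (splitAt s x) (splitAt s y)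
comet-dist s t conn x y = dist-potential (comet s (suc t)) y
  (λ z → cometDist (splitAt s z) (splitAt s y))
  (cometDist-refl (splitAt s y))
  (λ {z} eq → trans (sym (join-splitAt s (suc t) z))
    (trans (cong (join s (suc t)) (cometDist-zero (splitAt s z) (splitAt s y) eq))
           (join-splitAt s (suc t) y)))
  (λ a → cometDist-lipschitz (splitAt s y) (comet-adj⁻ s t a))
  descent conn x
  where
  descent : ∀ {z k} → cometDist (splitAt s z) (splitAt s y) ≡ suc k →
            ∃ λ z′ → Adj (comet s (suc t)) z z′ × cometDist (splitAt s z′) (splitAt s y) ≡ k
  descent {z} eq with cometDist-descent (splitAt s z) (splitAt s y) eq
  ... | p , a , eq′ = join s (suc t) p
    , subst (λ w → Adj (comet s (suc t)) w (join s (suc t) p)) (join-splitAt s (suc t) z)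
        (comet-adj⁺ s t a)
    , trans (cong (λ w → cometDist w (splitAt s y)) (splitAt-join s (suc t) p)) eq′

-- From list sums over distinct pairs to double sums.

sum-map-filter : {A : Set} {P : A → Set} (P? : U.Decidable P) (f : A → ℕ) →
                 (∀ x → ¬ P x → f x ≡ 0) → ∀ xs →
                 List.sum (map f (filter P? xs)) ≡ List.sum (map f xs)
sum-map-filter P? f f≡0 []       = refl
sum-map-filter P? f f≡0 (x ∷ xs) with P? x
... | yes _ = cong (λ k → f x + k) (sum-map-filter P? f f≡0 xs)
... | no ¬p = trans (sum-map-filter P? f f≡0 xs) (cong (_+ List.sum (map f xs)) (sym (f≡0 x ¬p)))

sum-map-cartesianProduct : {A B : Set} (f : A × B → ℕ) (xs : List A) (ys : List B) →
  List.sum (map f (cartesianProduct xs ys))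
    ≡ List.sum (map (λ x → List.sum (map (λ y → f (x , y)) ys)) xs)
sum-map-cartesianProduct f []       ys = refl
sum-map-cartesianProduct f (x ∷ xs) ys = begin
  List.sum (map f (map (x ,_) ys ++ rest))
    ≡⟨ cong List.sum (map-++ f (map (x ,_) ys) rest) ⟩
  List.sum (map f (map (x ,_) ys) ++ map f rest)
    ≡⟨ sum-++ (map f (map (x ,_) ys)) (map f rest) ⟩
  List.sum (map f (map (x ,_) ys)) + List.sum (map f rest)
    ≡⟨ cong₂ _+_ (cong List.sum (sym (map-∘ ys))) (sum-map-cartesianProduct f xs ys) ⟩
  List.sum (map (λ y → f (x , y)) ys)
    + List.sum (map (λ x → List.sum (map (λ y → f (x , y)) ys)) xs) ∎
  where
  open ≡-Reasoning
  rest = cartesianProduct xs ys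

sum-tabulate : ∀ n (f : Fin n → ℕ) → List.sum (tabulate f) ≡ ∑[ i < n ] f i
sum-tabulate zero    f = refl
sum-tabulate (suc n) f = cong (λ k → f zero + k) (sum-tabulate n (f ∘ suc))

sum-map-allFin : ∀ n (f : Fin n → ℕ) → List.sum (map f (allFin n)) ≡ ∑[ i < n ] f i
sum-map-allFin n f = trans (cong List.sum (map-tabulate id f)) (sum-tabulate n f)

-- Zero diagonal terms may be restored without changing the sum; the pairs then form a full product,
-- which is summed row by row.
sum-distinctPairs : ∀ n (f : Fin n → Fin n → ℕ) → (∀ i → f i i ≡ 0) →
  List.sum (map (λ (i , j) → f i j) (distinctPairs n)) ≡ ∑[ i < n ] ∑[ j < n ] f i j
sum-distinctPairs n f f-diag = begin
  List.sum (map f′ (distinctPairs n))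
    ≡⟨ sum-map-filter _ f′ vanish (cartesianProduct (allFin n) (allFin n)) ⟩
  List.sum (map f′ (cartesianProduct (allFin n) (allFin n)))
    ≡⟨ sum-map-cartesianProduct f′ (allFin n) (allFin n) ⟩
  List.sum (map (λ i → List.sum (map (f i) (allFin n))) (allFin n))
    ≡⟨ sum-map-allFin n _ ⟩
  ∑[ i < n ] List.sum (map (f i) (allFin n))
    ≡⟨ sum-cong-≗ (λ i → sum-map-allFin n (f i)) ⟩
  ∑[ i < n ] ∑[ j < n ] f i j ∎
  where
  open ≡-Reasoning
  f′ : Fin n × Fin n → ℕ
  f′ (i , j) = f i j
  -- A pair rejected by the filter satisfies only the double negation of equality; decidability
  -- removes it.
  vanish : ∀ p → ¬ (proj₁ p ≢ proj₂ p) → f′ p ≡ 0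
  vanish (i , j) ¬i≢j with refl ← decidable-stable (i ≟ j) ¬i≢j = f-diag i

-- Evaluation of the finite sums.

∑-const : ∀ n c → ∑[ i < n ] c ≡ n * c
∑-const zero    c = refl
∑-const (suc n) c = cong (λ k → c + k) (∑-const n c)

∑-↑ : ∀ m n (f : Fin (m + n) → ℕ) →
      ∑[ x < m + n ] f x ≡ ∑[ i < m ] f (i ↑ˡ n) + ∑[ j < n ] f (m ↑ʳ j)
∑-↑ zero    n f = refl
∑-↑ (suc m) n f =
  trans (cong (λ k → f zero + k) (∑-↑ m n (f ∘ suc))) (sym (ℕ.+-assoc (f zero) _ _))

∑-splitAt : ∀ m n (f : Fin m ⊎ Fin n → ℕ) →
            ∑[ x < m + n ] f (splitAt m x) ≡ ∑[ i < m ] f (inj₁ i) + ∑[ j < n ] f (inj₂ j)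
∑-splitAt m n f = trans (∑-↑ m n (f ∘ splitAt m)) (cong₂ _+_
  (sum-cong-≗ (λ i → cong f (splitAt-↑ˡ m i n)))
  (sum-cong-≗ (λ j → cong f (splitAt-↑ʳ m n j))))

-- Only the term `j = i` vanishes; each of the other `n` terms is 2.
∑-leafDist : ∀ (i : Fin (suc n)) → ∑[ j < suc n ] leafDist i j ≡ n * 2
∑-leafDist {n}     zero    = ∑-const n 2
∑-leafDist {suc n} (suc i) = cong (λ k → 2 + k) (∑-leafDist i)

triangular : ℕ → ℕ
triangular n = ∑[ i < n ] suc (toℕ i)

-- The factor 2 avoids division. Splitting off the first term shifts the remaining indices by one,
-- which adds `n` to the smaller sum.
2*triangular : ∀ n → 2 * triangular n ≡ n * suc n
2*triangular zero    = refl
2*triangular (suc n) = begin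
  2 * suc (∑[ i < n ] suc (suc (toℕ i)))
    ≡⟨ cong (λ k → 2 * suc k) (trans (∑-distrib-+ {n} (λ _ → 1) (suc ∘ toℕ))
         (cong (_+ triangular n) (∑-const n 1))) ⟩
  2 * suc (n * 1 + triangular n)  ≡⟨ expand n (triangular n) ⟩
  2 + 2 * n + 2 * triangular n    ≡⟨ cong (λ k → 2 + 2 * n + k) (2*triangular n) ⟩
  2 + 2 * n + n * suc n           ≡⟨ collect n ⟩
  suc n * suc (suc n)             ∎
  where
  open ≡-Reasoning
  expand : ∀ n r → 2 * suc (n * 1 + r) ≡ 2 + 2 * n + 2 * r
  expand = solve-∀
  collect : ∀ n → 2 + 2 * n + n * suc n ≡ suc n * suc (suc n)
  collect = solve-∀

pathSum : ℕ → ℕ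
pathSum n = ∑[ i < n ] ∑[ j < n ] ∣ toℕ i - toℕ j ∣

-- Removing the end vertex 0 removes one row and one column, each summing to `triangular n`; the
-- differences among the shifted indices are unchanged.
pathSum-suc : ∀ n → pathSum (suc n) ≡ 2 * triangular n + pathSum n
pathSum-suc n = begin
  triangular n + ∑[ i < n ] (suc (toℕ i) + ∑[ j < n ] ∣ toℕ i - toℕ j ∣)
    ≡⟨ cong (λ k → triangular n + k) (∑-distrib-+ {n} (suc ∘ toℕ) _) ⟩
  triangular n + (triangular n + pathSum n)
    ≡⟨ double (triangular n) (pathSum n) ⟩
  2 * triangular n + pathSum n ∎
  where
  open ≡-Reasoning
  double : ∀ r p → r + (r + p) ≡ 2 * r + p
  double = solve-∀

-- For a path of order m = `suc n` the value is (m - 1)m(m + 1); the successor form avoids truncated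
-- subtraction.
3*pathSum : ∀ n → 3 * pathSum (suc n) ≡ n * suc n * suc (suc n)
3*pathSum zero    = refl
3*pathSum (suc n) = begin
  3 * pathSum (suc (suc n))
    ≡⟨ cong (3 *_) (pathSum-suc (suc n)) ⟩
  3 * (2 * triangular (suc n) + pathSum (suc n))
    ≡⟨ ℕ.*-distribˡ-+ 3 (2 * triangular (suc n)) (pathSum (suc n)) ⟩
  3 * (2 * triangular (suc n)) + 3 * pathSum (suc n)
    ≡⟨ cong₂ (λ r p → 3 * r + p) (2*triangular (suc n)) (3*pathSum n) ⟩
  3 * (suc n * suc (suc n)) + n * suc n * suc (suc n)
    ≡⟨ collect n ⟩
  suc n * suc (suc n) * suc (suc (suc n)) ∎
  where
  open ≡-Reasoning
  collect : ∀ n → 3 * (suc n * suc (suc n)) + n * suc n * suc (suc n)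
                ≡ suc n * suc (suc n) * suc (suc (suc n))
  collect = solve-∀

-- The distance matrix has four blocks, according to whether each endpoint is a leaf or on the path.
-- With `suc s` leaves, every leaf has `s` others at distance 2.
∑-cometDist : ∀ s t →
  ∑[ x < suc s + t ] ∑[ y < suc s + t ] cometDist (splitAt (suc s) x) (splitAt (suc s) y)
    ≡ suc s * (s * 2 + triangular t) + (suc s * triangular t + pathSum t)
∑-cometDist s t = begin
  ∑[ x < suc s + t ] ∑[ y < suc s + t ] cometDist (splitAt (suc s) x) (splitAt (suc s) y)
    ≡⟨ sum-cong-≗ (λ x → ∑-splitAt (suc s) t (cometDist (splitAt (suc s) x))) ⟩
  ∑[ x < suc s + t ] row (splitAt (suc s) x)
    ≡⟨ ∑-splitAt (suc s) t row ⟩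
  ∑[ i < suc s ] row (inj₁ i) + ∑[ j < t ] row (inj₂ j)
    ≡⟨ cong₂ _+_ leafRows pathRows ⟩
  suc s * (s * 2 + triangular t) + (suc s * triangular t + pathSum t) ∎
  where
  open ≡-Reasoning
  row : Fin (suc s) ⊎ Fin t → ℕ
  row p = ∑[ i < suc s ] cometDist p (inj₁ i) + ∑[ j < t ] cometDist p (inj₂ j)

  leafRows : ∑[ i < suc s ] row (inj₁ i) ≡ suc s * (s * 2 + triangular t)
  leafRows = trans (sum-cong-≗ {suc s} (λ i → cong (_+ triangular t) (∑-leafDist {s} i)))
                   (∑-const (suc s) (s * 2 + triangular t))

  pathRows : ∑[ j < t ] row (inj₂ j) ≡ suc s * triangular t + pathSum t
  pathRows = trans (∑-distrib-+ {t} (λ j → ∑[ i < suc s ] suc (toℕ j)) _)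
    -- Exchanging the summations makes the sum for each leaf equal to `triangular t`.
    (cong (_+ pathSum t) (trans (∑-comm {t} {suc s} (λ j _ → suc (toℕ j)))
                                (∑-const (suc s) (triangular t))))

-- The distance sum and the agglomeration of the comet.

comet-distanceSum : ∀ s t (conn : Connected (comet (suc s) (suc t))) →
  3 * distanceSum (comet (suc s) (suc t)) conn
    ≡ suc t * (suc t + 1) * (t + 3 * suc s) + 6 * suc s * s
comet-distanceSum s t conn = begin
  3 * distanceSum (comet (suc s) (suc t)) conn
    ≡⟨ cong (3 *_) (sum-distinctPairs N (dist (comet (suc s) (suc t)) conn)
         (λ x → trans (comet-dist (suc s) t conn x x) (cometDist-refl (splitAt (suc s) x)))) ⟩
  3 * (∑[ x < N ] ∑[ y < N ] dist (comet (suc s) (suc t)) conn x y)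
    ≡⟨ cong (3 *_) (sum-cong-≗ (λ x → sum-cong-≗ (comet-dist (suc s) t conn x))) ⟩
  3 * (∑[ x < N ] ∑[ y < N ] cometDist (splitAt (suc s) x) (splitAt (suc s) y))
    ≡⟨ cong (3 *_) (∑-cometDist s (suc t)) ⟩
  3 * (suc s * (s * 2 + triangular (suc t)) + (suc s * triangular (suc t) + pathSum (suc t)))
    ≡⟨ expand s (triangular (suc t)) (pathSum (suc t)) ⟩
  6 * suc s * s + 3 * suc s * (2 * triangular (suc t)) + 3 * pathSum (suc t)
    ≡⟨ cong₂ (λ r p → 6 * suc s * s + 3 * suc s * r + p) (2*triangular (suc t)) (3*pathSum t) ⟩
  6 * suc s * s + 3 * suc s * (suc t * suc (suc t)) + t * suc t * suc (suc t)
    -- The last two summands share the factor `suc t * suc (suc t)`, leaving `t + 3 * suc s`.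
    ≡⟨ collect s t ⟩
  suc t * (suc t + 1) * (t + 3 * suc s) + 6 * suc s * s ∎
  where
  open ≡-Reasoning
  N = suc s + suc t
  expand : ∀ s r p → 3 * (suc s * (s * 2 + r) + (suc s * r + p))
                   ≡ 6 * suc s * s + 3 * suc s * (2 * r) + 3 * p
  expand = solve-∀
  collect : ∀ s t → 6 * suc s * s + 3 * suc s * (suc t * suc (suc t)) + t * suc t * suc (suc t)
                  ≡ suc t * (suc t + 1) * (t + 3 * suc s) + 6 * suc s * s
  collect = solve-∀

-- The quotients in `ℚ` are images under `fromℚᵘ` of unnormalised fractions, where equality is
-- cross-multiplication, so no gcd has to be computed.
/-cross : ∀ a b c d .{{_ : NonZero b}} .{{_ : NonZero d}} →
          a * d ≡ c * b → + a / b ≡ + c / d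
/-cross a (suc b) c (suc d) eq = fromℚᵘ-cong {mkℚᵘ (+ a) b} {mkℚᵘ (+ c) d} (*≡*
  (trans (sym (ℤ.pos-* a (suc d))) (trans (cong +_ eq) (ℤ.pos-* c (suc b)))))

lemma2p2p1 : ∀ (s t : ℕ) .{{_ : NonZero s}} .{{_ : NonZero t}} →
    agglomeration {{comet-nonTrivial s t}} (comet s t) (comet-connected s t)
    ≡ (+ (3 * (s + t ∸ 1)) / (t * (t + 1) * (t + 3 * s ∸ 1) + 6 * s * (s ∸ 1))) {{denominator-nonZero s t}}
lemma2p2p1 (suc s) (suc t) =
  -- With both parameters successors, each `∸ 1` reduces away and the stated denominator becomes
  -- `E`, which is `3 * D` by `comet-distanceSum`.
  /-cross (s + suc t) D (3 * (s + suc t)) E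
    {{distanceSum-nonZero {{comet-nonTrivial (suc s) (suc t)}} C conn}}
    {{denominator-nonZero (suc s) (suc t)}} (begin
    (s + suc t) * E        ≡⟨ cong ((s + suc t) *_) (comet-distanceSum s t conn) ⟨
    (s + suc t) * (3 * D)  ≡⟨ rearrange (s + suc t) D ⟩
    3 * (s + suc t) * D    ∎)
  where
  open ≡-Reasoning
  C = comet (suc s) (suc t)
  conn = comet-connected (suc s) (suc t)
  D = distanceSum C conn
  E = suc t * (suc t + 1) * (t + 3 * suc s) + 6 * suc s * s
  rearrange : ∀ n d → n * (3 * d) ≡ 3 * n * d
  rearrange = solve-∀
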